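{- For every integer $m\ge 4$, every two-solution ordinal algorithm for makespan minimization on $m$ identical machines has a competitive ratio of at least $\frac43$.
   Context: Ordinal makespan scheduling on $m$ identical machines. Jobs are indexed by positive integers. A realization is a sequence of real job sizes $p_1\ge p_2\ge p_3\ge\cdots\ge 0$ with only finitely many positive sizes. A solution is a partition of the set of all positive integers into $m$ sets $J_1,\dots,J_m$ (some may be empty), where $J_i$ is the set of jobs assigned to machine $i$; it is fixed without knowledge of the realization. For a realization, the load of machine $i$ in the solution is $\sum_{j\in J_i}p_j$, and the completion time of the solution is the maximum load of any machine. A two-solution ordinal algorithm consists of two solutions; its makespan for a realization is the minimum of the completion times of its two solutions for that realization. The optimal offline completion time $\lambda$ of a realization is the minimum completion time over all solutions (chosen with full knowledge of the realization). The competitive ratio of the algorithm is the supremum, over all realizations with $\lambda>0$, of the ratio between its makespan and $\lambda$. -}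

module Defs where

open import Data.Bool.Base using (if_then_else_)
open import Data.Fin.Base using (Fin; toℕ)
open import Data.Fin.Properties using (_≟_)
open import Data.Nat.Base as ℕ using (ℕ; suc)
import Data.Nat.Properties as ℕₚ
open import Data.Product.Base using (∃-syntax; _×_; _,_; proj₁; proj₂)
open import Data.Rational.Base as ℚ using (ℚ; 0ℚ; 1ℚ; ½; 1/_; Positive; NonNegative; NonZero)
import Data.Rational.Properties as ℚₚ
open import Data.Rational.Solver using (module +-*-Solver)
open import Data.Sum.Base using (inj₁; inj₂)
open import Data.Vec.Functional using (foldr)
open import Level using (0ℓ)
open import Relation.Binary.PropositionalEquality using (_≡_; refl; sym; trans; cong; cong₂; subst)
open import Relation.Nullary.Decidable.Core using (does)
open import Relation.Unary using (Pred; _⊆_)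

------------------------------------------------------------------------
-- Real numbers as Cauchy sequences of rationals

Cauchy : (ℕ → ℚ) → Set
Cauchy x = ∀ ε → 0ℚ ℚ.< ε →
  ∃[ N ] (∀ k l → N ℕ.≤ k → N ℕ.≤ l → ℚ.∣ x k ℚ.- x l ∣ ℚ.< ε)

record ℝ : Set where
  constructor mkℝ
  field
    seq    : ℕ → ℚ
    cauchy : Cauchy seq

open ℝ public

infix 4 _<_ _≤_ _≃_

_<_ : ℝ → ℝ → Set
x < y = ∃[ ε ] (0ℚ ℚ.< ε ×
  ∃[ N ] (∀ k → N ℕ.≤ k → seq x k ℚ.+ ε ℚ.≤ seq y k))

_≤_ : ℝ → ℝ → Set
x ≤ y = ∀ ε → 0ℚ ℚ.< ε →
  ∃[ N ] (∀ k → N ℕ.≤ k → seq x k ℚ.≤ seq y k ℚ.+ ε)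

-- Different Cauchy sequences may represent the same real number, so
-- equality of reals is _≃_ rather than _≡_.

_≃_ : ℝ → ℝ → Set
x ≃ y = x ≤ y × y ≤ x

private
  ∣p-p∣≡0 : ∀ p → ℚ.∣ p ℚ.- p ∣ ≡ 0ℚ
  ∣p-p∣≡0 p = cong ℚ.∣_∣ (ℚₚ.+-inverseʳ p)

  p≤∣p∣ : ∀ p → p ℚ.≤ ℚ.∣ p ∣
  p≤∣p∣ p with ℚₚ.≤-total 0ℚ p
  ... | inj₁ 0≤p = ℚₚ.≤-reflexive (sym (ℚₚ.0≤p⇒∣p∣≡p 0≤p))
  ... | inj₂ p≤0 = ℚₚ.≤-trans p≤0 (ℚₚ.0≤∣p∣ p)

  q+[p-q]≡p : ∀ p q → q ℚ.+ (p ℚ.- q) ≡ p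
  q+[p-q]≡p = solve 2 (λ p q → q :+ (p :- q) := p) refl
    where open +-*-Solver

  q+r-q≡r : ∀ q r → (q ℚ.+ r) ℚ.- q ≡ r
  q+r-q≡r = solve 2 (λ q r → (q :+ r) :- q := r) refl
    where open +-*-Solver

  ∣p-q∣≡∣q-p∣ : ∀ p q → ℚ.∣ p ℚ.- q ∣ ≡ ℚ.∣ q ℚ.- p ∣
  ∣p-q∣≡∣q-p∣ p q = trans (cong ℚ.∣_∣ (lemma p q)) (ℚₚ.∣-p∣≡∣p∣ (q ℚ.- p))
    where
    open +-*-Solver
    lemma : ∀ p q → p ℚ.- q ≡ ℚ.- (q ℚ.- p)
    lemma = solve 2 (λ p q → p :- q := :- (q :- p)) refl

  ∣p∣≤∣q∣+∣p-q∣ : ∀ p q → ℚ.∣ p ∣ ℚ.≤ ℚ.∣ q ∣ ℚ.+ ℚ.∣ p ℚ.- q ∣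
  ∣p∣≤∣q∣+∣p-q∣ p q = subst (λ h → ℚ.∣ h ∣ ℚ.≤ ℚ.∣ q ∣ ℚ.+ ℚ.∣ p ℚ.- q ∣)
    (q+[p-q]≡p p q) (ℚₚ.∣p+q∣≤∣p∣+∣q∣ q (p ℚ.- q))

  below : ∀ p q {ε} → ℚ.∣ p ℚ.- q ∣ ℚ.< ε → p ℚ.< q ℚ.+ ε
  below p q {ε} d = subst (ℚ._< q ℚ.+ ε) (q+[p-q]≡p p q)
    (ℚₚ.+-monoʳ-< q (ℚₚ.≤-<-trans (p≤∣p∣ (p ℚ.- q)) d))

  above : ∀ p q {ε} → ℚ.∣ p ℚ.- q ∣ ℚ.< ε → q ℚ.< p ℚ.+ ε
  above p q d = below q p (subst (ℚ._< _) (∣p-q∣≡∣q-p∣ p q) d)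

  p-q<ε : ∀ p q {ε} → p ℚ.< q ℚ.+ ε → p ℚ.- q ℚ.< ε
  p-q<ε p q {ε} lt = subst (p ℚ.- q ℚ.<_) (q+r-q≡r q ε) (ℚₚ.+-monoˡ-< (ℚ.- q) lt)

  within : ∀ p q {ε} → p ℚ.< q ℚ.+ ε → q ℚ.< p ℚ.+ ε → ℚ.∣ p ℚ.- q ∣ ℚ.< ε
  within p q p<q+ε q<p+ε with ℚₚ.≤-total 0ℚ (p ℚ.- q) | ℚₚ.≤-total 0ℚ (q ℚ.- p)
  ... | inj₁ 0≤p-q | _ = subst (ℚ._< _) (sym (ℚₚ.0≤p⇒∣p∣≡p 0≤p-q)) (p-q<ε p q p<q+ε)
  ... | inj₂ _ | inj₁ 0≤q-p = subst (ℚ._< _)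
    (sym (trans (∣p-q∣≡∣q-p∣ p q) (ℚₚ.0≤p⇒∣p∣≡p 0≤q-p))) (p-q<ε q p q<p+ε)
  ... | inj₂ p-q≤0 | inj₂ q-p≤0 = subst (ℚ._< _) (sym (cong ℚ.∣_∣ p-q≡0))
    (subst (ℚ._< _) p-q≡0 (p-q<ε p q p<q+ε))
    where
    open +-*-Solver
    -[q-p] : ∀ p q → ℚ.- (q ℚ.- p) ≡ p ℚ.- q
    -[q-p] = solve 2 (λ p q → :- (q :- p) := p :- q) refl
    p-q≡0 : p ℚ.- q ≡ 0ℚ
    p-q≡0 = ℚₚ.≤-antisym p-q≤0
      (subst (0ℚ ℚ.≤_) (-[q-p] p q) (ℚₚ.neg-antimono-≤ q-p≤0))

  ⊔-< : ∀ {p q r} → p ℚ.< r → q ℚ.< r → p ℚ.⊔ q ℚ.< r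
  ⊔-< {p} {q} p<r q<r with ℚₚ.⊔-sel p q
  ... | inj₁ eq = subst (ℚ._< _) (sym eq) p<r
  ... | inj₂ eq = subst (ℚ._< _) (sym eq) q<r

  ⊓-< : ∀ {p q r} → r ℚ.< p → r ℚ.< q → r ℚ.< p ℚ.⊓ q
  ⊓-< {p} {q} r<p r<q with ℚₚ.⊓-sel p q
  ... | inj₁ eq = subst (_ ℚ.<_) (sym eq) r<p
  ... | inj₂ eq = subst (_ ℚ.<_) (sym eq) r<q

  ⊔-below : ∀ p q r s {ε} → p ℚ.< r ℚ.+ ε → q ℚ.< s ℚ.+ ε →
            p ℚ.⊔ q ℚ.< (r ℚ.⊔ s) ℚ.+ ε
  ⊔-below p q r s {ε} p<r+ε q<s+ε = ⊔-<
    (ℚₚ.<-≤-trans p<r+ε (ℚₚ.+-monoˡ-≤ ε (ℚₚ.p≤p⊔q r s)))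
    (ℚₚ.<-≤-trans q<s+ε (ℚₚ.+-monoˡ-≤ ε (ℚₚ.p≤q⊔p r s)))

  ⊓-below : ∀ p q r s {ε} → p ℚ.< r ℚ.+ ε → q ℚ.< s ℚ.+ ε →
            p ℚ.⊓ q ℚ.< (r ℚ.⊓ s) ℚ.+ ε
  ⊓-below p q r s {ε} p<r+ε q<s+ε with ℚₚ.⊓-sel r s
  ... | inj₁ eq = subst (λ h → p ℚ.⊓ q ℚ.< h ℚ.+ ε) (sym eq)
    (ℚₚ.≤-<-trans (ℚₚ.p⊓q≤p p q) p<r+ε)
  ... | inj₂ eq = subst (λ h → p ℚ.⊓ q ℚ.< h ℚ.+ ε) (sym eq)
    (ℚₚ.≤-<-trans (ℚₚ.p⊓q≤q p q) q<s+ε)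

  0<½* : ∀ {ε} → 0ℚ ℚ.< ε → 0ℚ ℚ.< ½ ℚ.* ε
  0<½* 0<ε = ℚₚ.*-monoʳ-<-pos ½ 0<ε

  halves : ∀ ε → ½ ℚ.* ε ℚ.+ ½ ℚ.* ε ≡ ε
  halves ε = trans (sym (ℚₚ.*-distribʳ-+ ε ½ ½)) (ℚₚ.*-identityˡ ε)

  -- Combines two sequences by an operation that is nonexpansive for the
  -- maximum norm.
  nonexpansive : (_∙_ : ℚ → ℚ → ℚ) →
    (∀ p q r s {ε} → p ℚ.< r ℚ.+ ε → q ℚ.< s ℚ.+ ε → (p ∙ q) ℚ.< (r ∙ s) ℚ.+ ε) →
    ∀ x y → Cauchy (λ k → seq x k ∙ seq y k)
  nonexpansive _∙_ mono x y ε 0<ε with cauchy x ε 0<ε | cauchy y ε 0<ε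
  ... | M , hx | N , hy = M ℕ.⊔ N , λ k l k≥ l≥ →
    let
      dx = hx k l (ℕₚ.m⊔n≤o⇒m≤o M N k≥) (ℕₚ.m⊔n≤o⇒m≤o M N l≥)
      dy = hy k l (ℕₚ.m⊔n≤o⇒n≤o M N k≥) (ℕₚ.m⊔n≤o⇒n≤o M N l≥)
      a = seq x k ; b = seq y k ; c = seq x l ; d = seq y l
    in within (a ∙ b) (c ∙ d)
         (mono a b c d (below a c dx) (below b d dy))
         (mono c d a b (above a c dx) (above b d dy))

  +-cauchy : ∀ x y → Cauchy (λ k → seq x k ℚ.+ seq y k)
  +-cauchy x y ε 0<ε with cauchy x (½ ℚ.* ε) (0<½* 0<ε) | cauchy y (½ ℚ.* ε) (0<½* 0<ε)
  ... | M , hx | N , hy = M ℕ.⊔ N , λ k l k≥ l≥ →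
    let
      a = seq x k ; b = seq y k ; c = seq x l ; d = seq y l
    in begin-strict
      ℚ.∣ (a ℚ.+ b) ℚ.- (c ℚ.+ d) ∣
        ≡⟨ cong ℚ.∣_∣ (regroup a b c d) ⟩
      ℚ.∣ (a ℚ.- c) ℚ.+ (b ℚ.- d) ∣
        ≤⟨ ℚₚ.∣p+q∣≤∣p∣+∣q∣ (a ℚ.- c) (b ℚ.- d) ⟩
      ℚ.∣ a ℚ.- c ∣ ℚ.+ ℚ.∣ b ℚ.- d ∣
        <⟨ ℚₚ.+-mono-<
             (hx k l (ℕₚ.m⊔n≤o⇒m≤o M N k≥) (ℕₚ.m⊔n≤o⇒m≤o M N l≥))
             (hy k l (ℕₚ.m⊔n≤o⇒n≤o M N k≥) (ℕₚ.m⊔n≤o⇒n≤o M N l≥)) ⟩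
      ½ ℚ.* ε ℚ.+ ½ ℚ.* ε
        ≡⟨ halves ε ⟩
      ε ∎
    where
    open ℚₚ.≤-Reasoning
    regroup : ∀ a b c d → (a ℚ.+ b) ℚ.- (c ℚ.+ d) ≡ (a ℚ.- c) ℚ.+ (b ℚ.- d)
    regroup = solve 4 (λ a b c d → (a :+ b) :- (c :+ d) := (a :- c) :+ (b :- d)) refl
      where open +-*-Solver

  *-estimate : ∀ {A B δ} a b c d → 0ℚ ℚ.< A → 0ℚ ℚ.< B →
    ℚ.∣ a ∣ ℚ.≤ A → ℚ.∣ d ∣ ℚ.≤ B → ℚ.∣ a ℚ.- c ∣ ℚ.< δ → ℚ.∣ b ℚ.- d ∣ ℚ.< δ →
    ℚ.∣ a ℚ.* b ℚ.- c ℚ.* d ∣ ℚ.< (A ℚ.+ B) ℚ.* δ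
  *-estimate {A} {B} {δ} a b c d 0<A 0<B ∣a∣≤A ∣d∣≤B ∣a-c∣<δ ∣b-d∣<δ = begin-strict
    ℚ.∣ a ℚ.* b ℚ.- c ℚ.* d ∣
      ≡⟨ cong ℚ.∣_∣ (regroup a b c d) ⟩
    ℚ.∣ a ℚ.* (b ℚ.- d) ℚ.+ (a ℚ.- c) ℚ.* d ∣
      ≤⟨ ℚₚ.∣p+q∣≤∣p∣+∣q∣ (a ℚ.* (b ℚ.- d)) ((a ℚ.- c) ℚ.* d) ⟩
    ℚ.∣ a ℚ.* (b ℚ.- d) ∣ ℚ.+ ℚ.∣ (a ℚ.- c) ℚ.* d ∣
      ≡⟨ cong₂ ℚ._+_ (ℚₚ.∣p*q∣≡∣p∣*∣q∣ a (b ℚ.- d)) (ℚₚ.∣p*q∣≡∣p∣*∣q∣ (a ℚ.- c) d) ⟩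
    ℚ.∣ a ∣ ℚ.* ℚ.∣ b ℚ.- d ∣ ℚ.+ ℚ.∣ a ℚ.- c ∣ ℚ.* ℚ.∣ d ∣
      ≤⟨ ℚₚ.+-mono-≤
           (ℚₚ.*-monoʳ-≤-nonNeg ℚ.∣ b ℚ.- d ∣ {{ℚₚ.∣-∣-nonNeg (b ℚ.- d)}} ∣a∣≤A)
           (ℚₚ.*-monoˡ-≤-nonNeg ℚ.∣ a ℚ.- c ∣ {{ℚₚ.∣-∣-nonNeg (a ℚ.- c)}} ∣d∣≤B) ⟩
    A ℚ.* ℚ.∣ b ℚ.- d ∣ ℚ.+ ℚ.∣ a ℚ.- c ∣ ℚ.* B
      <⟨ ℚₚ.+-mono-<
           (ℚₚ.*-monoʳ-<-pos A {{ℚ.positive 0<A}} ∣b-d∣<δ)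
           (ℚₚ.*-monoˡ-<-pos B {{ℚ.positive 0<B}} ∣a-c∣<δ) ⟩
    A ℚ.* δ ℚ.+ δ ℚ.* B
      ≡⟨ cong (A ℚ.* δ ℚ.+_) (ℚₚ.*-comm δ B) ⟩
    A ℚ.* δ ℚ.+ B ℚ.* δ
      ≡⟨ ℚₚ.*-distribʳ-+ δ A B ⟨
    (A ℚ.+ B) ℚ.* δ ∎
    where
    open ℚₚ.≤-Reasoning
    regroup : ∀ a b c d → a ℚ.* b ℚ.- c ℚ.* d ≡ a ℚ.* (b ℚ.- d) ℚ.+ (a ℚ.- c) ℚ.* d
    regroup = solve 4 (λ a b c d → a :* b :- c :* d := a :* (b :- d) :+ (a :- c) :* d) refl
      where open +-*-Solver

  0<p+q : ∀ {p q} → 0ℚ ℚ.< p → 0ℚ ℚ.< q → 0ℚ ℚ.< p ℚ.+ q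
  0<p+q {p} {q} 0<p 0<q = ℚₚ.+-mono-< {0ℚ} {p} {0ℚ} {q} 0<p 0<q

  quotient : ∀ {p ε} → 0ℚ ℚ.< p → 0ℚ ℚ.< ε → ∃[ δ ] (0ℚ ℚ.< δ × p ℚ.* δ ≡ ε)
  quotient {p} {ε} 0<p 0<ε = 1/ p ℚ.* ε
    , subst (ℚ._< 1/ p ℚ.* ε) (ℚₚ.*-zeroʳ (1/ p))
        (ℚₚ.*-monoʳ-<-pos (1/ p) {{ℚₚ.1/pos⇒pos p}} 0<ε)
    , trans (sym (ℚₚ.*-assoc p (1/ p) ε))
        (trans (cong (ℚ._* ε) (ℚₚ.*-inverseʳ p)) (ℚₚ.*-identityˡ ε))
    where
    instance
      p>0 : Positive p
      p>0 = ℚ.positive 0<p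
      p≢0 : NonZero p
      p≢0 = ℚₚ.pos⇒nonZero p

  EventuallyBounded : (ℕ → ℚ) → Set
  EventuallyBounded x = ∃[ B ] (0ℚ ℚ.< B × ∃[ N ] (∀ k → N ℕ.≤ k → ℚ.∣ x k ∣ ℚ.≤ B))

  bounded : ∀ x → Cauchy x → EventuallyBounded x
  bounded x h = fromTail (h 1ℚ (ℚₚ.positive⁻¹ 1ℚ))
    where
    fromTail : ∃[ N ] (∀ k l → N ℕ.≤ k → N ℕ.≤ l → ℚ.∣ x k ℚ.- x l ∣ ℚ.< 1ℚ) →
            EventuallyBounded x
    fromTail (N , h₁) = ℚ.∣ x N ∣ ℚ.+ 1ℚ
      , ℚₚ.+-mono-≤-< {0ℚ} {ℚ.∣ x N ∣} {0ℚ} {1ℚ} (ℚₚ.0≤∣p∣ (x N)) (ℚₚ.positive⁻¹ 1ℚ)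
      , N , λ k N≤k → ℚₚ.≤-trans (∣p∣≤∣q∣+∣p-q∣ (x k) (x N))
          (ℚₚ.+-monoʳ-≤ ℚ.∣ x N ∣ (ℚₚ.<⇒≤ (h₁ k N N≤k ℕₚ.≤-refl)))

  *-cauchy′ : ∀ x y → Cauchy x → Cauchy y → EventuallyBounded x → EventuallyBounded y →
              Cauchy (λ k → x k ℚ.* y k)
  *-cauchy′ x y hx hy (A , 0<A , K , ∣x∣≤A) (B , 0<B , L , ∣y∣≤B) ε 0<ε =
    combine (quotient {A ℚ.+ B} {ε} (0<p+q 0<A 0<B) 0<ε)
    where
    Close : Set
    Close = ∃[ N ] (∀ k l → N ℕ.≤ k → N ℕ.≤ l → ℚ.∣ x k ℚ.* y k ℚ.- x l ℚ.* y l ∣ ℚ.< ε)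

    close : ∀ {δ} → (A ℚ.+ B) ℚ.* δ ≡ ε →
      ∃[ M ] (∀ k l → M ℕ.≤ k → M ℕ.≤ l → ℚ.∣ x k ℚ.- x l ∣ ℚ.< δ) →
      ∃[ N ] (∀ k l → N ℕ.≤ k → N ℕ.≤ l → ℚ.∣ y k ℚ.- y l ∣ ℚ.< δ) → Close
    close {δ} [A+B]δ≡ε (M , hM) (N , hN) = (K ℕ.⊔ L) ℕ.⊔ (M ℕ.⊔ N) , λ k l k≥ l≥ →
      let
        k≥₁ = ℕₚ.m⊔n≤o⇒m≤o (K ℕ.⊔ L) (M ℕ.⊔ N) k≥
        k≥₂ = ℕₚ.m⊔n≤o⇒n≤o (K ℕ.⊔ L) (M ℕ.⊔ N) k≥
        l≥₁ = ℕₚ.m⊔n≤o⇒m≤o (K ℕ.⊔ L) (M ℕ.⊔ N) l≥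
        l≥₂ = ℕₚ.m⊔n≤o⇒n≤o (K ℕ.⊔ L) (M ℕ.⊔ N) l≥
      in subst (ℚ.∣ x k ℚ.* y k ℚ.- x l ℚ.* y l ∣ ℚ.<_) [A+B]δ≡ε
           (*-estimate {A} {B} {δ} (x k) (y k) (x l) (y l) 0<A 0<B
             (∣x∣≤A k (ℕₚ.m⊔n≤o⇒m≤o K L k≥₁))
             (∣y∣≤B l (ℕₚ.m⊔n≤o⇒n≤o K L l≥₁))
             (hM k l (ℕₚ.m⊔n≤o⇒m≤o M N k≥₂) (ℕₚ.m⊔n≤o⇒m≤o M N l≥₂))
             (hN k l (ℕₚ.m⊔n≤o⇒n≤o M N k≥₂) (ℕₚ.m⊔n≤o⇒n≤o M N l≥₂)))

    combine : ∃[ δ ] (0ℚ ℚ.< δ × (A ℚ.+ B) ℚ.* δ ≡ ε) → Close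
    combine (δ , 0<δ , [A+B]δ≡ε) = close [A+B]δ≡ε (hx δ 0<δ) (hy δ 0<δ)

  *-cauchy : ∀ x y → Cauchy (λ k → seq x k ℚ.* seq y k)
  *-cauchy x y = *-cauchy′ (seq x) (seq y) (cauchy x) (cauchy y)
    (bounded (seq x) (cauchy x)) (bounded (seq y) (cauchy y))

fromℚ : ℚ → ℝ
fromℚ q = mkℝ (λ _ → q) λ ε 0<ε → 0 , λ _ _ _ _ →
  subst (ℚ._< ε) (sym (∣p-p∣≡0 q)) 0<ε

0ℝ : ℝ
0ℝ = fromℚ 0ℚ

infixl 6 _+_ _⊔_
infixl 7 _*_ _⊓_

_+_ : ℝ → ℝ → ℝ
x + y = mkℝ (λ k → seq x k ℚ.+ seq y k) (+-cauchy x y)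

_*_ : ℝ → ℝ → ℝ
x * y = mkℝ (λ k → seq x k ℚ.* seq y k) (*-cauchy x y)

_⊔_ : ℝ → ℝ → ℝ
x ⊔ y = mkℝ (λ k → seq x k ℚ.⊔ seq y k) (nonexpansive ℚ._⊔_ ⊔-below x y)

_⊓_ : ℝ → ℝ → ℝ
x ⊓ y = mkℝ (λ k → seq x k ℚ.⊓ seq y k) (nonexpansive ℚ._⊓_ ⊓-below x y)

------------------------------------------------------------------------
-- Suprema

-- An extended real is represented by the set of rationals strictly below
-- it. The supremum of a set of reals is then the union of their lower
-- cuts. It always exists, whereas a Cauchy real need not exist
-- constructively even for a bounded inhabited set.

LowerReal : Set₁
LowerReal = Pred ℚ 0ℓ

infix 4 _≤ˡ_

_≤ˡ_ : LowerReal → LowerReal → Set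
a ≤ˡ b = a ⊆ b

lower : ℝ → LowerReal
lower x q = fromℚ q < x

sup : Pred ℝ 0ℓ → LowerReal
sup S q = ∃[ x ] (S x × lower x q)

------------------------------------------------------------------------
-- Ordinal makespan scheduling

-- Jobs are numbered from zero: size j is p_{j+1}.

record Realization : Set where
  field
    size       : ℕ → ℝ
    decreasing : ∀ j → size (suc j) ≤ size j
    nonneg     : ∀ j → 0ℝ ≤ size j
    bound      : ℕ
    finite     : ∀ j → bound ℕ.≤ j → size j ≃ 0ℝ

open Realization public

-- A partition of the jobs into m possibly empty sets, given by the machine
-- of each job; J_i is the fibre over i.

Solution : ℕ → Set
Solution m = ℕ → Fin m

-- All jobs from bound R onwards have size zero, so they are left out of the
-- sum.

load : ∀ {m} → Solution m → Realization → Fin m → ℝ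
load S R i = foldr _+_ 0ℝ
  (λ (j : Fin (bound R)) → if does (S (toℕ j) ≟ i) then size R (toℕ j) else 0ℝ)

-- Loads are nonnegative, so starting from 0ℝ does not affect the maximum
-- when there is at least one machine.

completionTime : ∀ {m} → Solution m → Realization → ℝ
completionTime S R = foldr _⊔_ 0ℝ (load S R)

IsOptimalCompletionTime : ℕ → Realization → ℝ → Set
IsOptimalCompletionTime m R opt =
  (∃[ S ] completionTime {m} S R ≃ opt) ×
  (∀ (S : Solution m) → opt ≤ completionTime S R)

TwoSolutionAlgorithm : ℕ → Set
TwoSolutionAlgorithm m = Solution m × Solution m

makespan : ∀ {m} → TwoSolutionAlgorithm m → Realization → ℝ
makespan (S , T) R = completionTime S R ⊓ completionTime T R

-- r is the quotient of makespan and optimum, stated without division.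

Ratio : ∀ {m} → TwoSolutionAlgorithm m → Pred ℝ 0ℓ
Ratio {m} A r = ∃[ R ] ∃[ opt ]
  (IsOptimalCompletionTime m R opt × 0ℝ < opt × r * opt ≃ makespan A R)

competitiveRatio : ∀ {m} → TwoSolutionAlgorithm m → LowerReal
competitiveRatio A = sup (Ratio A)

{-# OPTIONS --safe #-}
module Submission where

-- Consider instances with integral sizes in which every machine gets load
-- exactly 3 in an optimal solution. Any other solution has a load of at least
-- 4, hence ratio at least 4/3, so it suffices to find one such instance that
-- neither solution of the algorithm solves optimally. With k = m − 4, take
--   X = 3ᵏ 3 3 1 1 1 1 1 1,  Y = 3ᵏ 3 2 2 1 1 1 1 1,  Z = 3ᵏ 2 2 2 2 1 1 1 1.
-- They have equally many jobs. If a solution is optimal for one of them, then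
-- a job of size 3 there is alone on its machine; if that job has size 2 in
-- another of the three, its machine has load only 2 there. So every solution
-- fails on one of any two of X, Y, Z, that is on two of the three, and two
-- solutions fail on a common instance.

open import Data.Bool.Base using (Bool; true; false; if_then_else_)
open import Data.Fin.Base using (Fin; zero; suc; toℕ)
open import Data.Fin.Patterns using (0F; 1F; 2F; 3F)
open import Data.Fin.Properties using (_≟_; all?)
open import Data.Integer.Base using (+_)
open import Data.List.Base using (List; []; _∷_; length)
open import Data.List.Relation.Binary.Pointwise using (Pointwise; []; _∷_; decidable)
open import Data.List.Relation.Unary.Linked using (Linked; []; [-]; _∷_; linked?)
import Data.Nat.ListAction as List
open import Data.Nat.Base using (ℕ; zero; suc; z≤n; s≤s; _+_; _*_; _∸_; _≤_; _<_; _≥_)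
open import Data.Nat.Properties renaming (_≟_ to _≟ᴺ_)
open import Data.Nat.Tactic.RingSolver using (solve-∀)
open import Data.Product.Base using (∃-syntax; _×_; _,_)
open import Data.Rational.Base as ℚ using (0ℚ; 1ℚ; ℚ; _/_)
import Data.Rational.Properties as ℚₚ
open import Data.Sum.Base using (_⊎_; inj₁; inj₂)
open import Data.Vec.Functional using (Vector; foldr)
open import Function.Base using (_∘_)
open import Relation.Binary.PropositionalEquality using (_≡_; refl; sym; trans; cong; cong₂; subst; module ≡-Reasoning)
open import Relation.Nullary.Decidable using (True; does; from-yes; toWitness; dec-true)
open import Defs as D using (ℝ; seq; fromℚ; 0ℝ; lower; _≃_; Solution; Realization; TwoSolutionAlgorithm;
  IsOptimalCompletionTime; completionTime; makespan; Ratio; competitiveRatio; _≤ˡ_)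

open import Algebra.Properties.CommutativeMonoid.Sum +-0-commutativeMonoid using (sum; sum-cong-≗; sum-replicate-zero; ∑-distrib-+)
open import Algebra.Properties.Monoid.Mult ℚₚ.+-0-monoid using () renaming (_×_ to _·_; ×-homo-+ to ·-homo-+)

-- Loads of integral job lists

size : List ℕ → ℕ → ℕ
size []       _       = 0
size (x ∷ _)  zero    = x
size (_ ∷ xs) (suc j) = size xs j

load : ∀ {m} → Solution m → List ℕ → Fin m → ℕ
load S []       i = 0
load S (x ∷ xs) i = (if does (S 0 ≟ i) then x else 0) + load (S ∘ suc) xs i

size≤load : ∀ {m} (S : Solution m) xs j {i} → S j ≡ i → size xs j ≤ load S xs i
size≤load S []       j       eq = z≤n
size≤load S (x ∷ xs) zero    {i} eq rewrite dec-true (S 0 ≟ i) eq = m≤m+n x _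
size≤load S (x ∷ xs) (suc j) {i} eq =
  m≤n⇒m≤o+n (if does (S 0 ≟ i) then x else 0) (size≤load (S ∘ suc) xs j eq)

if-scale : ∀ c (b : Bool) {x y} → y ≤ c * x → (if b then y else 0) ≤ c * (if b then x else 0)
if-scale c true  y≤cx = y≤cx
if-scale c false _    = z≤n

load-scale : ∀ {m xs ys} c (S : Solution m) i → Pointwise (λ x y → y ≤ c * x) xs ys →
  load S ys i ≤ c * load S xs i
load-scale c S i [] = z≤n
load-scale {xs = x ∷ xs} c S i (y≤cx ∷ r) =
  ≤-trans (+-mono-≤ (if-scale c (does (S 0 ≟ i)) y≤cx) (load-scale c (S ∘ suc) i r))
    (≤-reflexive (sym (*-distribˡ-+ c (if does (S 0 ≟ i) then x else 0) _)))

-- The load excess over job j satisfies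
--   load S ys i − size ys j ≤ c * (load S xs i − size xs j);
-- terms are moved to avoid subtraction.
excess-scale : ∀ {m xs ys} c (S : Solution m) j {i} → S j ≡ i →
  Pointwise (λ x y → y ≤ c * x) xs ys →
  load S ys i + c * size xs j ≤ c * load S xs i + size ys j
excess-scale c S j eq [] = m≤m+n (c * 0) 0
excess-scale {xs = x ∷ xs} {y ∷ ys} c S zero {i} eq (y≤cx ∷ r)
  rewrite dec-true (S 0 ≟ i) eq = begin
    y + load (S ∘ suc) ys i + c * x        ≤⟨ +-monoˡ-≤ (c * x) (+-monoʳ-≤ y (load-scale c (S ∘ suc) i r)) ⟩
    y + c * load (S ∘ suc) xs i + c * x    ≡⟨ regroup c x y (load (S ∘ suc) xs i) ⟩
    c * (x + load (S ∘ suc) xs i) + y      ∎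
  where
  open ≤-Reasoning
  regroup : ∀ c x y l → y + c * l + c * x ≡ c * (x + l) + y
  regroup = solve-∀
excess-scale {xs = x ∷ xs} {y ∷ ys} c S (suc j) {i} eq (y≤cx ∷ r) = begin
    y₀ + load (S ∘ suc) ys i + c * size xs j      ≡⟨ +-assoc y₀ _ _ ⟩
    y₀ + (load (S ∘ suc) ys i + c * size xs j)
      ≤⟨ +-mono-≤ (if-scale c (does (S 0 ≟ i)) y≤cx) (excess-scale c (S ∘ suc) j eq r) ⟩
    c * x₀ + (c * load (S ∘ suc) xs i + size ys j)  ≡⟨ regroup c x₀ (load (S ∘ suc) xs i) (size ys j) ⟩
    c * (x₀ + load (S ∘ suc) xs i) + size ys j      ∎
  where
  open ≤-Reasoning
  x₀ = if does (S 0 ≟ i) then x else 0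
  y₀ = if does (S 0 ≟ i) then y else 0
  regroup : ∀ c x l s → c * x + (c * l + s) ≡ c * (x + l) + s
  regroup = solve-∀

-- Sums over the machines

sum-indicator : ∀ {m} (a : Fin m) x → sum (λ i → if does (a ≟ i) then x else 0) ≡ x
sum-indicator {suc m} zero    x = trans (cong (_+_ x) (sum-replicate-zero m)) (+-identityʳ x)
sum-indicator {suc m} (suc a) x = sum-indicator a x

-- Every job contributes to exactly one machine, so the total load is the same for all solutions.
sum-load : ∀ {m} (S : Solution m) xs → sum (load S xs) ≡ List.sum xs
sum-load {m} S []       = sum-replicate-zero m
sum-load     S (x ∷ xs) = trans
  (∑-distrib-+ (λ i → if does (S 0 ≟ i) then x else 0) (load (S ∘ suc) xs))
  (cong₂ _+_ (sum-indicator (S 0) x) (sum-load (S ∘ suc) xs))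

sum->⇒∃> : ∀ {m} (f g : Vector ℕ m) → sum g < sum f → ∃[ i ] g i < f i
sum->⇒∃> {suc m} f g Σg<Σf with <-≤-connex (g 0F) (f 0F)
... | inj₁ g<f = 0F , g<f
... | inj₂ f≤g with sum->⇒∃> (f ∘ suc) (g ∘ suc)
  (+-cancelˡ-< (f 0F) _ _ (≤-<-trans (+-monoˡ-≤ _ f≤g) Σg<Σf))
...   | i , g<f = suc i , g<f

-- A deficit at one index must be made up at another. If the deficit is at the head, the tails
-- satisfy a strict inequality of sums. Otherwise either the head itself is the surplus, or removing
-- it preserves the inequality of sums.
sum-≥∧<⇒∃> : ∀ {m} (f g : Vector ℕ m) → sum g ≤ sum f → ∀ i → f i < g i → ∃[ j ] g j < f j
sum-≥∧<⇒∃> f g Σg≤Σf zero f<g with sum->⇒∃> (f ∘ suc) (g ∘ suc)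
  (+-cancelˡ-< (f 0F) _ _ (<-≤-trans (+-monoˡ-< _ f<g) Σg≤Σf))
... | j , g<f = suc j , g<f
sum-≥∧<⇒∃> f g Σg≤Σf (suc i) fi<gi with <-≤-connex (g 0F) (f 0F)
... | inj₁ g<f = 0F , g<f
... | inj₂ f≤g with sum-≥∧<⇒∃> (f ∘ suc) (g ∘ suc)
  (+-cancelˡ-≤ (f 0F) _ _ (≤-trans (+-monoˡ-≤ _ f≤g) Σg≤Σf)) i fi<gi
...   | j , g<f = suc j , g<f

-- Balanced instances and overloaded solutions

record BalancedInstance (m : ℕ) : Set where
  field
    sizes      : List ℕ
    decreasing : ∀ j → size sizes (suc j) ≤ size sizes j
    balanced   : Solution m
    load≡3     : ∀ i → load balanced sizes i ≡ 3

open BalancedInstance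

Overloaded : ∀ {m} → BalancedInstance m → Solution m → Set
Overloaded I S = ∃[ i ] 3 < load S (sizes I) i

module _ {m} (I : BalancedInstance m) (S : Solution m) where

  sum-3≤sum-load : sum {m} (λ _ → 3) ≤ sum (load S (sizes I))
  sum-3≤sum-load = ≤-reflexive (begin
    sum {m} (λ _ → 3)                    ≡⟨ sum-cong-≗ (load≡3 I) ⟨
    sum (load (balanced I) (sizes I))    ≡⟨ sum-load (balanced I) (sizes I) ⟩
    List.sum (sizes I)                   ≡⟨ sum-load S (sizes I) ⟨
    sum (load S (sizes I))               ∎)
    where open ≡-Reasoning

  underloaded⇒overloaded : ∀ i → load S (sizes I) i < 3 → Overloaded I S
  underloaded⇒overloaded = sum-≥∧<⇒∃> (load S (sizes I)) (λ _ → 3) sum-3≤sum-load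

  ∃load≥3 : ∃[ i ] 3 ≤ load S (sizes I) i
  ∃load≥3 with <-≤-connex (load S (sizes I) (S 0)) 3
  ... | inj₂ 3≤l = S 0 , 3≤l
  ... | inj₁ l<3 with underloaded⇒overloaded (S 0) l<3
  ...   | i , 3<l = i , <⇒≤ 3<l

-- If the machine of job `j` has load at most 3 in `I`, its excess over job `j` is zero there. By
-- `excess-scale` the excess is then zero in `J` as well, so in `J` this machine carries only the
-- size of job `j`, which is below 3, and some other machine is overloaded.
overloaded-either : ∀ {m} c (I J : BalancedInstance m) →
  Pointwise (λ x y → y ≤ c * x) (sizes I) (sizes J) →
  ∀ j → size (sizes I) j ≡ 3 → size (sizes J) j < 3 →
  ∀ S → Overloaded I S ⊎ Overloaded J S
overloaded-either c I J r j Ij≡3 Jj<3 S with <-≤-connex 3 (load S (sizes I) (S j))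
... | inj₁ 3<l = inj₁ (S j , 3<l)
... | inj₂ l≤3 = inj₂ (underloaded⇒overloaded J S (S j) (≤-<-trans J-load≤ Jj<3))
  where
  open ≤-Reasoning
  J-load≤ : load S (sizes J) (S j) ≤ size (sizes J) j
  J-load≤ = +-cancelˡ-≤ (c * 3) _ _ (begin
    c * 3 + load S (sizes J) (S j)                     ≡⟨ +-comm (c * 3) _ ⟩
    load S (sizes J) (S j) + c * 3                     ≡⟨ cong (λ x → load S (sizes J) (S j) + c * x) Ij≡3 ⟨
    load S (sizes J) (S j) + c * size (sizes I) j      ≤⟨ excess-scale c S j refl r ⟩
    c * load S (sizes I) (S j) + size (sizes J) j      ≤⟨ +-monoˡ-≤ _ (*-monoʳ-≤ c l≤3) ⟩
    c * 3 + size (sizes J) j                           ∎)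

-- Padding with machines that hold one job of size 3

prepend3 : ∀ {m} → BalancedInstance m → BalancedInstance (suc m)
prepend3 {m} I = record
  { sizes      = 3 ∷ sizes I
  ; decreasing = λ where
      -- No job of `I` exceeds 3, the load of its machine in the balanced solution, so a leading 3
      -- keeps the order.
      zero    → ≤-trans (size≤load (balanced I) (sizes I) 0 refl) (≤-reflexive (load≡3 I _))
      (suc j) → decreasing I j
  ; balanced   = S
  ; load≡3     = λ where
      zero    → cong (_+_ 3) (load-zero (balanced I) (sizes I))
      (suc i) → trans (load-suc (balanced I) (sizes I) i) (load≡3 I i)
  }
  where
  S : Solution (suc m)
  S zero    = zero
  S (suc j) = suc (balanced I j)

  load-zero : ∀ (T : Solution m) xs → load (suc ∘ T) xs 0F ≡ 0
  load-zero T []       = refl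
  load-zero T (x ∷ xs) = load-zero (T ∘ suc) xs

  load-suc : ∀ (T : Solution m) xs i → load (suc ∘ T) xs (suc i) ≡ load T xs i
  load-suc T []       i = refl
  load-suc T (x ∷ xs) i = cong (_+_ (if does (T 0 ≟ i) then x else 0)) (load-suc (T ∘ suc) xs i)

pad : ∀ {m} k → BalancedInstance m → BalancedInstance (k + m)
pad zero    I = I
pad (suc k) I = prepend3 (pad k I)

size-pad : ∀ {m} k (I : BalancedInstance m) j → size (sizes (pad k I)) (k + j) ≡ size (sizes I) j
size-pad zero    I j = refl
size-pad (suc k) I j = size-pad k I j

pad-pointwise : ∀ {m} (R : ℕ → ℕ → Set) (I J : BalancedInstance m) k → R 3 3 →
  Pointwise R (sizes I) (sizes J) → Pointwise R (sizes (pad k I)) (sizes (pad k J))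
pad-pointwise R I J zero    R33 r = r
pad-pointwise R I J (suc k) R33 r = R33 ∷ pad-pointwise R I J k R33 r

-- Three instances on four machines

linked⇒decreasing : ∀ {xs} → Linked _≥_ xs → ∀ j → size xs (suc j) ≤ size xs j
linked⇒decreasing []        j       = z≤n
linked⇒decreasing [-]       j       = z≤n
linked⇒decreasing (x≥y ∷ l) zero    = x≥y
linked⇒decreasing (x≥y ∷ l) (suc j) = linked⇒decreasing l j

-- The default `0F` concerns only jobs past the end of the list, which have size 0 in the instances
-- below.
assign : ∀ {m} → List (Fin (suc m)) → Solution (suc m)
assign []       _       = 0F
assign (i ∷ _)  zero    = i
assign (_ ∷ is) (suc j) = assign is j

fromLists : ∀ {m} xs (is : List (Fin (suc m))) → {True (linked? _≥?_ xs)} →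
  {True (all? λ i → load (assign is) xs i ≟ᴺ 3)} → BalancedInstance (suc m)
fromLists xs is {xs↘} {≡3} = record
  { sizes      = xs
  ; decreasing = linked⇒decreasing (toWitness xs↘)
  ; balanced   = assign is
  ; load≡3     = toWitness ≡3
  }

X Y Z : BalancedInstance 4
X = fromLists (3 ∷ 3 ∷ 1 ∷ 1 ∷ 1 ∷ 1 ∷ 1 ∷ 1 ∷ []) (0F ∷ 1F ∷ 2F ∷ 2F ∷ 2F ∷ 3F ∷ 3F ∷ 3F ∷ [])
Y = fromLists (3 ∷ 2 ∷ 2 ∷ 1 ∷ 1 ∷ 1 ∷ 1 ∷ 1 ∷ []) (0F ∷ 1F ∷ 2F ∷ 1F ∷ 2F ∷ 3F ∷ 3F ∷ 3F ∷ [])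
Z = fromLists (2 ∷ 2 ∷ 2 ∷ 2 ∷ 1 ∷ 1 ∷ 1 ∷ 1 ∷ []) (0F ∷ 1F ∷ 2F ∷ 3F ∷ 0F ∷ 1F ∷ 2F ∷ 3F ∷ [])

-- The factor 2 covers the pairs of instances used below, where a size grows at most from 1 to 2.
-- Padding moves job `j` to position `k + j`.
overloaded-either-padded : ∀ {m} k (I J : BalancedInstance m) →
  Pointwise (λ x y → y ≤ 2 * x) (sizes I) (sizes J) →
  ∀ j → size (sizes I) j ≡ 3 → size (sizes J) j < 3 →
  ∀ S → Overloaded (pad k I) S ⊎ Overloaded (pad k J) S
overloaded-either-padded k I J r j Ij≡3 Jj<3 =
  overloaded-either 2 (pad k I) (pad k J) (pad-pointwise (λ x y → y ≤ 2 * x) I J k (m≤m+n 3 3) r) (k + j)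
    (trans (size-pad k I j) Ij≡3)
    (subst (_< 3) (sym (size-pad k J j)) Jj<3)

common-overload : ∀ k (S T : Solution (k + 4)) → ∃[ I ] Overloaded {k + 4} I S × Overloaded I T
common-overload k S T with XY S | XZ S | YZ S | XY T | XZ T | YZ T
  where
  ≤2*? = λ (x y : ℕ) → y ≤? 2 * x
  -- Job 1 has size 3 in `X` but 2 in `Y` and `Z`; job 0 has size 3 in `Y` but 2 in `Z`.
  XY = overloaded-either-padded k X Y (from-yes (decidable ≤2*? (sizes X) (sizes Y))) 1 refl ≤-refl
  XZ = overloaded-either-padded k X Z (from-yes (decidable ≤2*? (sizes X) (sizes Z))) 1 refl ≤-refl
  YZ = overloaded-either-padded k Y Z (from-yes (decidable ≤2*? (sizes Y) (sizes Z))) 0 refl ≤-refl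
-- The first disjunction gives an instance on which `S` fails. If neither disjunction for `T` that
-- involves this instance selects it, `T` fails on both others, and the disjunction for `S` between
-- those two decides which one is common.
... | inj₁ x | _      | _      | inj₁ x′ | _       | _       = pad k X , x , x′
... | inj₁ x | _      | _      | _       | inj₁ x′ | _       = pad k X , x , x′
... | inj₁ _ | _      | inj₁ y | inj₂ y′ | _       | _       = pad k Y , y , y′
... | inj₁ _ | _      | inj₂ z | _       | inj₂ z′ | _       = pad k Z , z , z′
... | inj₂ y | _      | _      | inj₂ y′ | _       | _       = pad k Y , y , y′
... | inj₂ y | _      | _      | _       | _       | inj₁ y′ = pad k Y , y , y′
... | inj₂ _ | inj₁ x | _      | inj₁ x′ | _       | _       = pad k X , x , x′
... | inj₂ _ | inj₂ z | _      | _       | _       | inj₂ z′ = pad k Z , z , z′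

-- Passage from integral lists to real realizations

pointwise-≤ : ∀ {x y} → (∀ k → seq x k ℚ.≤ seq y k) → x D.≤ y
pointwise-≤ {x} {y} x≤y ε 0<ε = 0 , λ k _ → ℚₚ.≤-trans (x≤y k)
  (subst (ℚ._≤ seq y k ℚ.+ ε) (ℚₚ.+-identityʳ (seq y k)) (ℚₚ.+-monoʳ-≤ (seq y k) (ℚₚ.<⇒≤ 0<ε)))

pointwise-≃ : ∀ {x y} → (∀ k → seq x k ≡ seq y k) → x ≃ y
pointwise-≃ {x} {y} x≡y =
  pointwise-≤ {x} {y} (ℚₚ.≤-reflexive ∘ x≡y) , pointwise-≤ {y} {x} (ℚₚ.≤-reflexive ∘ sym ∘ x≡y)

-- As an iterated sum of `1ℚ`, this embedding gets additivity from `·-homo-+` and evaluates on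
-- numerals.
fromℕ : ℕ → ℚ
fromℕ n = n · 1ℚ

fromℕ-+ : ∀ m n → fromℕ (m + n) ≡ fromℕ m ℚ.+ fromℕ n
fromℕ-+ = ·-homo-+ 1ℚ

0≤fromℕ : ∀ n → 0ℚ ℚ.≤ fromℕ n
0≤fromℕ zero    = ℚₚ.≤-refl
0≤fromℕ (suc n) = ℚₚ.+-mono-≤ (ℚₚ.<⇒≤ (ℚₚ.positive⁻¹ 1ℚ)) (0≤fromℕ n)

fromℕ-mono-≤ : ∀ {m n} → m ≤ n → fromℕ m ℚ.≤ fromℕ n
fromℕ-mono-≤ {n = n} z≤n = 0≤fromℕ n
fromℕ-mono-≤ (s≤s m≤n)   = ℚₚ.+-monoʳ-≤ 1ℚ (fromℕ-mono-≤ m≤n)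

seq≤seq-⊔ : ∀ {m} (f : Vector ℝ m) i k → seq (f i) k ℚ.≤ seq (foldr D._⊔_ 0ℝ f) k
seq≤seq-⊔ f zero    k = ℚₚ.p≤p⊔q _ _
seq≤seq-⊔ f (suc i) k = ℚₚ.≤-trans (seq≤seq-⊔ (f ∘ suc) i k) (ℚₚ.p≤q⊔p (seq (f 0F) k) _)

seq-⊔-lub : ∀ {m} (f : Vector ℝ m) {q} k → 0ℚ ℚ.≤ q → (∀ i → seq (f i) k ℚ.≤ q) →
  seq (foldr D._⊔_ 0ℝ f) k ℚ.≤ q
seq-⊔-lub {zero}  f k 0≤q f≤q = 0≤q
seq-⊔-lub {suc m} f k 0≤q f≤q = ℚₚ.⊔-lub (f≤q 0F) (seq-⊔-lub (f ∘ suc) k 0≤q (f≤q ∘ suc))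

size-beyond : ∀ xs j → length xs ≤ j → size xs j ≡ 0
size-beyond []       j       _         = refl
size-beyond (x ∷ xs) (suc j) (s≤s n≤j) = size-beyond xs j n≤j

realize : ∀ {m} → BalancedInstance m → Realization
realize I = record
  { size       = p
  ; decreasing = λ j → pointwise-≤ {p (suc j)} {p j} λ _ → fromℕ-mono-≤ (decreasing I j)
  ; nonneg     = λ j → pointwise-≤ {0ℝ} {p j} λ _ → 0≤fromℕ (size (sizes I) j)
  ; bound      = length (sizes I)
  ; finite     = λ j n≤j → pointwise-≃ {p j} {0ℝ} λ _ → cong fromℕ (size-beyond (sizes I) j n≤j)
  }
  where
  p : ℕ → ℝ
  p j = fromℚ (fromℕ (size (sizes I) j))

seq-load : ∀ {m} (S : Solution m) (I : BalancedInstance m) i k →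
  seq (D.load S (realize I) i) k ≡ fromℕ (load S (sizes I) i)
seq-load {m} S₀ I i k = go S₀ (sizes I)
  where
  head-term : ∀ b x → seq (if b then fromℚ (fromℕ x) else 0ℝ) k ≡ fromℕ (if b then x else 0)
  head-term true  x = refl
  head-term false x = refl

  -- The induction ranges over arbitrary lists, since the tail of a balanced instance need not be
  -- balanced.
  go : ∀ (S : Solution m) xs → seq (foldr D._+_ 0ℝ (λ (j : Fin (length xs)) →
       if does (S (toℕ j) ≟ i) then fromℚ (fromℕ (size xs (toℕ j))) else 0ℝ)) k
       ≡ fromℕ (load S xs i)
  go S []       = refl
  go S (x ∷ xs) = trans (cong₂ ℚ._+_ (head-term (does (S 0 ≟ i)) x) (go (S ∘ suc) xs))
    (sym (fromℕ-+ (if does (S 0 ≟ i) then x else 0) (load (S ∘ suc) xs i)))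

load≥⇒seq-completionTime≥ : ∀ {m} (S : Solution m) (I : BalancedInstance m) n →
  ∃[ i ] n ≤ load S (sizes I) i →
  ∀ k → fromℕ n ℚ.≤ seq (completionTime S (realize I)) k
load≥⇒seq-completionTime≥ S I n (i , n≤l) k = begin
  fromℕ n                             ≤⟨ fromℕ-mono-≤ {n} {load S (sizes I) i} n≤l ⟩
  fromℕ (load S (sizes I) i)          ≡⟨ seq-load S I i k ⟨
  seq (D.load S (realize I) i) k      ≤⟨ seq≤seq-⊔ (D.load S (realize I)) i k ⟩
  seq (completionTime S (realize I)) k ∎
  where open ℚₚ.≤-Reasoning

3ℝ : ℝ
3ℝ = fromℚ (fromℕ 3)

-- The balanced solution attains 3, and since the average load is 3, every solution has a machine
-- with at least that load.
optimal-3 : ∀ {m} (I : BalancedInstance m) → IsOptimalCompletionTime m (realize I) 3ℝ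
optimal-3 I = (balanced I , pointwise-≤ {completion (balanced I)} {3ℝ} upper , 3≤completion (balanced I))
  , 3≤completion
  where
  completion = λ S → completionTime S (realize I)

  3≤completion : ∀ S → 3ℝ D.≤ completion S
  3≤completion S = pointwise-≤ {3ℝ} {completion S} (load≥⇒seq-completionTime≥ S I 3 (∃load≥3 I S))

  upper : ∀ k → seq (completion (balanced I)) k ℚ.≤ fromℕ 3
  upper k = seq-⊔-lub (D.load (balanced I) (realize I)) k (0≤fromℕ 3) λ i →
    ℚₚ.≤-reflexive (trans (seq-load (balanced I) I i k) (cong fromℕ (load≡3 I i)))

-- The lower bound on the competitive ratio

overloaded⇒ratio≥4/3 : ∀ {m} (I : BalancedInstance m) (S T : Solution m) →
  Overloaded I S → Overloaded I T → ∃[ r ] Ratio (S , T) r × (∀ k → + 4 / 3 ℚ.≤ seq r k)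
overloaded⇒ratio≥4/3 I S T S-over T-over =
  r , (realize I , 3ℝ , optimal-3 I , 0<3 , pointwise-≃ {r D.* 3ℝ} {M} r*3≡M) , 4/3≤r
  where
  M r : ℝ
  M = makespan (S , T) (realize I)
  r = M D.* fromℚ (+ 1 / 3)

  0<3 : 0ℝ D.< 3ℝ
  0<3 = 1ℚ , ℚₚ.positive⁻¹ 1ℚ , 0 , λ _ _ → fromℕ-mono-≤ {1} {3} (s≤s z≤n)

  r*3≡M : ∀ k → seq (r D.* 3ℝ) k ≡ seq M k
  r*3≡M k = trans (ℚₚ.*-assoc (seq M k) (+ 1 / 3) (fromℕ 3)) (ℚₚ.*-identityʳ (seq M k))

  4≤M : ∀ k → fromℕ 4 ℚ.≤ seq M k
  -- Integrality enters here: `3 < n` unfolds to `4 ≤ n`.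
  4≤M k = ℚₚ.⊓-glb (load≥⇒seq-completionTime≥ S I 4 S-over k) (load≥⇒seq-completionTime≥ T I 4 T-over k)

  4/3≤r : ∀ k → + 4 / 3 ℚ.≤ seq r k
  -- The product of `fromℕ 4` and `+ 1 / 3` evaluates to `+ 4 / 3`.
  4/3≤r k = ℚₚ.*-monoʳ-≤-nonNeg (+ 1 / 3) {fromℕ 4} (4≤M k)

<-pointwise-≤ : ∀ {x y z} → x D.< y → (∀ k → seq y k ℚ.≤ seq z k) → x D.< z
<-pointwise-≤ (ε , 0<ε , N , x+ε≤y) y≤z =
  ε , 0<ε , N , λ k N≤k → ℚₚ.≤-trans (x+ε≤y k N≤k) (y≤z k)

-- A single attained ratio of at least 4/3 puts every rational below 4/3 into the lower cut of the
-- supremum.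
bound-k+4 : ∀ k (A : TwoSolutionAlgorithm (k + 4)) → lower (fromℚ (+ 4 / 3)) ≤ˡ competitiveRatio A
bound-k+4 k (S , T) {q} q<4/3 =
  let I , S-over , T-over = common-overload k S T
      r , ratio , 4/3≤r   = overloaded⇒ratio≥4/3 I S T S-over T-over
  in r , ratio , <-pointwise-≤ {fromℚ q} {fromℚ (+ 4 / 3)} {r} q<4/3 4/3≤r

proposition8 : (m : ℕ) → m ≥ 4 → (A : TwoSolutionAlgorithm m) → lower (fromℚ (+ 4 / 3)) ≤ˡ competitiveRatio A
proposition8 m m≥4 = subst
  (λ n → (A : TwoSolutionAlgorithm n) → lower (fromℚ (+ 4 / 3)) ≤ˡ competitiveRatio A)
  (m∸n+n≡m m≥4) (bound-k+4 (m ∸ 4))
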